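{- Let $A=(a_{ij})$ be an $n\times n$ stochastic matrix with spectrum $(1;\lambda_2,\ldots,\lambda_n)$. For each $j=1,\ldots,n$ let $a_j$ and $s_j$ be the smallest entry and the sum of the $j$th column of $A$, respectively. If $$s_j\le 1+n a_j\qquad\text{for all } j=1,\ldots,n,$$ then there exists an $n\times n$ doubly stochastic matrix $B$ with spectrum $\sigma(B)=(1;\lambda_2,\ldots,\lambda_n)$. Moreover, $B$ is the unique closest doubly stochastic matrix to $A$ with respect to the Frobenius norm and has the property that $B$ is cospectral to $A$.
   Context: A stochastic matrix is a square matrix with nonnegative entries each of whose row sums equals $1$; it is doubly stochastic if in addition each column sum equals $1$. The spectrum of a matrix is the list of its eigenvalues counted with multiplicity; the semicolon after the first entry indicates that it is the Perron eigenvalue. Two matrices are cospectral if they have the same spectrum. -}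

module Defs where

open import Algebra.Apartness.Structures using (IsHeytingField)
open import Algebra.Bundles using (CommutativeRing; RawRing)
open import Algebra.Core using (Op₁; Op₂)
import Algebra.Definitions.RawMonoid as RawMonoidDefs
import Algebra.Properties.CommutativeMonoid.Sum as Sum
import Algebra.Properties.Ring as RingProperties
import Algebra.Properties.Semiring.Mult.TCOptimised as Mult
import Algebra.Solver.Ring as RingSolver
open import Algebra.Solver.Ring.AlmostCommutativeRing
  using (_-Raw-AlmostCommutative⟶_; fromCommutativeRing)
open import Data.Bool.Base using (if_then_else_)
open import Data.Fin.Base using (Fin; zero; suc; punchIn)
open import Data.Fin.Properties using (_≟_)
open import Data.Integer.Base as ℤ using (ℤ; +_; -[1+_])
import Data.Integer.Properties as ℤ
open import Data.Maybe.Base using (Maybe; just; nothing)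
open import Data.Nat.Base as ℕ using (ℕ; zero; suc)
import Data.Nat.Properties as ℕ
open import Data.Product.Base using (∃; ∃-syntax; _×_; _,_; proj₁; proj₂)
open import Data.Sum.Base using (_⊎_; inj₁; inj₂)
open import Data.Vec.Functional as Vector using (Vector)
open import Function.Bundles using (_⇔_)
open import Level using (_⊔_) renaming (suc to lsuc)
open import Relation.Binary.Core using (Rel)
open import Relation.Binary.Definitions using (Cotransitive)
open import Relation.Binary.Structures using (IsStrictPartialOrder)
open import Relation.Nullary.Decidable.Core using (does)
open import Relation.Nullary.Negation.Core using (¬_)
open import Relation.Unary using (Pred; _∈_; Satisfiable)
open import Relation.Nullary.Decidable.Core using (yes; no)
import Relation.Binary.PropositionalEquality.Core as ≡

module OrderNotions {c ℓ} {X : Set c} (_<_ : Rel X ℓ) where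

  infix 4 _≤_

  _≤_ : Rel X ℓ
  x ≤ y = ¬ (y < x)

  UpperBound : Pred X ℓ → X → Set (c ⊔ ℓ)
  UpperBound P u = ∀ {x} → x ∈ P → x ≤ u

  IsSup : Pred X ℓ → X → Set (c ⊔ ℓ)
  IsSup P s = UpperBound P s × (∀ u → UpperBound P u → s ≤ u)

  Located : Pred X ℓ → Set (c ⊔ ℓ)
  Located P = ∀ {x y} → x < y → UpperBound P y ⊎ ∃[ p ] (p ∈ P × x < p)

-- The library's ring solver over an arbitrary commutative ring, with integer
-- coefficients.  Used only in proofs.
module IntegerRingSolver {c ℓ} (R : CommutativeRing c ℓ) where
  open CommutativeRing R hiding (zero)
  open RingProperties ring
  open Mult semiring renaming (_×_ to _·_)
  open import Relation.Binary.Reasoning.Setoid setoid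

  private
    ⟦_⟧ᶻ : ℤ → Carrier
    ⟦ + n      ⟧ᶻ = n · 1#
    ⟦ -[1+ n ] ⟧ᶻ = - (suc n · 1#)

    reflexiveᶻ : ∀ {i j} → i ≡.≡ j → ⟦ i ⟧ᶻ ≈ ⟦ j ⟧ᶻ
    reflexiveᶻ ≡.refl = refl

    -‿homo : ∀ i → ⟦ ℤ.- i ⟧ᶻ ≈ - ⟦ i ⟧ᶻ
    -‿homo (+ zero)   = sym -0#≈0#
    -‿homo (+ suc n)  = refl
    -‿homo -[1+ n ]   = sym (-‿involutive _)

    ⊖-homo : ∀ m n → ⟦ m ℤ.⊖ n ⟧ᶻ ≈ m · 1# - n · 1#
    ⊖-homo zero    zero    = sym (-‿inverseʳ 0#)
    ⊖-homo zero    (suc n) = sym (+-identityˡ _)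
    ⊖-homo (suc m) zero    = sym (trans (+-congˡ -0#≈0#) (+-identityʳ _))
    ⊖-homo (suc m) (suc n) = begin
      ⟦ suc m ℤ.⊖ suc n ⟧ᶻ                    ≈⟨ reflexiveᶻ (ℤ.[1+m]⊖[1+n]≡m⊖n m n) ⟩
      ⟦ m ℤ.⊖ n ⟧ᶻ                            ≈⟨ ⊖-homo m n ⟩
      m · 1# - n · 1#                       ≈⟨ +-congʳ (xyx⁻¹≈y 1# (m · 1#)) ⟨
      (1# + m · 1# - 1#) - n · 1#           ≈⟨ +-assoc _ _ _ ⟩
      (1# + m · 1#) + (- 1# - n · 1#)       ≈⟨ +-cong (sym (1+× m 1#))
                                                 (trans (-‿+-comm 1# (n · 1#))
                                                        (-‿cong (sym (1+× n 1#)))) ⟩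
      suc m · 1# - suc n · 1#               ∎

    +-homo : ∀ i j → ⟦ i ℤ.+ j ⟧ᶻ ≈ ⟦ i ⟧ᶻ + ⟦ j ⟧ᶻ
    +-homo (+ m)    (+ n)    = ×-homo-+ 1# m n
    +-homo (+ m)    -[1+ n ] = ⊖-homo m (suc n)
    +-homo -[1+ m ] (+ n)    = trans (⊖-homo n (suc m)) (+-comm _ _)
    +-homo -[1+ m ] -[1+ n ] = begin
      - (suc (suc (m ℕ.+ n)) · 1#)       ≡⟨ ≡.cong (λ k → - (suc k · 1#)) (ℕ.+-suc m n) ⟨
      - ((suc m ℕ.+ suc n) · 1#)         ≈⟨ -‿cong (×-homo-+ 1# (suc m) (suc n)) ⟩
      - (suc m · 1# + suc n · 1#)        ≈⟨ -‿+-comm _ _ ⟨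
      - (suc m · 1#) + - (suc n · 1#)    ∎

    *-homo : ∀ i j → ⟦ i ℤ.* j ⟧ᶻ ≈ ⟦ i ⟧ᶻ * ⟦ j ⟧ᶻ
    *-homo (+ m) (+ n) =
      trans (reflexiveᶻ (ℤ.+◃n≡+n (m ℕ.* n))) (×1-homo-* m n)
    *-homo (+ m) -[1+ n ] = begin
      ⟦ + m ℤ.* -[1+ n ] ⟧ᶻ      ≈⟨ reflexiveᶻ (ℤ.-◃n≡-n (m ℕ.* suc n)) ⟩
      ⟦ ℤ.- + (m ℕ.* suc n) ⟧ᶻ   ≈⟨ -‿homo (+ (m ℕ.* suc n)) ⟩
      - ((m ℕ.* suc n) · 1#)     ≈⟨ -‿cong (×1-homo-* m (suc n)) ⟩
      - (m · 1# * (suc n · 1#))  ≈⟨ -‿distribʳ-* _ _ ⟩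
      m · 1# * - (suc n · 1#)    ∎
    *-homo -[1+ m ] (+ n) = begin
      ⟦ -[1+ m ] ℤ.* + n ⟧ᶻ      ≈⟨ reflexiveᶻ (ℤ.-◃n≡-n (suc m ℕ.* n)) ⟩
      ⟦ ℤ.- + (suc m ℕ.* n) ⟧ᶻ   ≈⟨ -‿homo (+ (suc m ℕ.* n)) ⟩
      - ((suc m ℕ.* n) · 1#)     ≈⟨ -‿cong (×1-homo-* (suc m) n) ⟩
      - (suc m · 1# * (n · 1#))  ≈⟨ -‿distribˡ-* _ _ ⟩
      - (suc m · 1#) * (n · 1#)  ∎
    *-homo -[1+ m ] -[1+ n ] = begin
      (suc m ℕ.* suc n) · 1#               ≈⟨ ×1-homo-* (suc m) (suc n) ⟩
      suc m · 1# * (suc n · 1#)            ≈⟨ -‿involutive _ ⟨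
      - - (suc m · 1# * (suc n · 1#))      ≈⟨ -‿cong (-‿distribˡ-* _ _) ⟩
      - (- (suc m · 1#) * (suc n · 1#))    ≈⟨ -‿distribʳ-* _ _ ⟩
      - (suc m · 1#) * - (suc n · 1#)      ∎

    ℤ-rawRing : RawRing _ _
    ℤ-rawRing = record
      { _≈_ = ≡._≡_ ; _+_ = ℤ._+_ ; _*_ = ℤ._*_ ; -_ = ℤ.-_ ; 0# = + 0 ; 1# = + 1 }

    morphism : ℤ-rawRing -Raw-AlmostCommutative⟶ fromCommutativeRing R
    morphism = record
      { ⟦_⟧ = ⟦_⟧ᶻ ; +-homo = +-homo ; *-homo = *-homo ; -‿homo = -‿homo
      ; 0-homo = refl ; 1-homo = refl }

    _coeff≟_ : ∀ i j → Maybe (⟦ i ⟧ᶻ ≈ ⟦ j ⟧ᶻ)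
    i coeff≟ j with i ℤ.≟ j
    ... | yes i≡j = just (reflexiveᶻ i≡j)
    ... | no  _   = nothing

  open RingSolver ℤ-rawRing (fromCommutativeRing R) morphism _coeff≟_ public
    using (solve; _:=_; _:+_; _:*_; :-_; con)

-- The real numbers, axiomatised as a Dedekind-complete ordered field.
-- The axioms are the constructive form of the usual ones (cotransitivity
-- in place of trichotomy, suprema for located sets only).  Classically
-- every set is located and < is trichotomous, so that a model is exactly
-- a complete ordered field, i.e. a copy of ℝ.
record Reals c ℓ : Set (lsuc (c ⊔ ℓ)) where
  infix  8 -_
  infixl 7 _*_
  infixl 6 _+_
  infix  4 _≈_ _<_
  field
    Carrier : Set c
    _≈_     : Rel Carrier ℓ
    _<_     : Rel Carrier ℓ
    _+_     : Op₂ Carrier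
    _*_     : Op₂ Carrier
    -_      : Op₁ Carrier
    0#      : Carrier
    1#      : Carrier
    isHeytingField       : IsHeytingField _≈_ (λ x y → x < y ⊎ y < x)
                             _+_ _*_ -_ 0# 1#
    isStrictPartialOrder : IsStrictPartialOrder _≈_ _<_
    <-cotrans            : Cotransitive _<_
    +-monoˡ-<            : ∀ {x y} z → x < y → x + z < y + z
    *-pos                : ∀ {x y} → 0# < x → 0# < y → 0# < x * y

  open OrderNotions _<_ public

  field
    sup : (P : Pred Carrier ℓ) → Satisfiable P → ∃ (UpperBound P) →
          Located P → ∃ (IsSup P)

  open IsHeytingField isHeytingField public
    using (isHeytingCommutativeRing; isCommutativeRing; #⇒invertible; tight)
  open IsStrictPartialOrder isStrictPartialOrder public
    using (<-resp-≈; <-respˡ-≈; <-respʳ-≈)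
    renaming (irrefl to <-irrefl; trans to <-trans; asym to <-asym)

  commutativeRing : CommutativeRing c ℓ
  commutativeRing = record { isCommutativeRing = isCommutativeRing }

  open CommutativeRing commutativeRing public
    hiding (Carrier; _≈_; _+_; _*_; -_; 0#; 1#; isCommutativeRing; zero)

module SquareRoot {c ℓ} (ℝ : Reals c ℓ) where
  open Reals ℝ

  open IntegerRingSolver commutativeRing

  private
    -‿cancel : ∀ a x → x + a + - a ≈ x
    -‿cancel = solve 2 (λ a x →
      x :+ a :+ :- a := x) refl

    +-monoʳ-< : ∀ z {x y} → x < y → z + x < z + y
    +-monoʳ-< z {x} {y} x<y =
      <-respˡ-≈ (+-comm x z) (<-respʳ-≈ (+-comm y z) (+-monoˡ-< z x<y))

    0<1 : 0# < 1#
    0<1 with IsHeytingField.invertible⇒# isHeytingField {1#} {0#}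
               (1# , lemma 1# , lemma′ 1#)
      where
      lemma : ∀ x → x * (1# + - 0#) ≈ x
      lemma = solve 1 (λ x →
        x :* (con (+ 1) :+ :- con (+ 0)) := x) refl
      lemma′ : ∀ x → (1# + - 0#) * x ≈ x
      lemma′ = solve 1 (λ x →
        (con (+ 1) :+ :- con (+ 0)) :* x := x) refl
    ... | inj₂ 0<1 = 0<1
    ... | inj₁ 1<0 = <-respʳ-≈ (sq 1#) (*-pos 0<-1 0<-1)
      where
      sq : ∀ x → - 1# * - 1# ≈ 1#
      sq = solve 1 (λ x →
        :- con (+ 1) :* :- con (+ 1) := con (+ 1)) refl
      0<-1 : 0# < - 1#
      0<-1 = <-respˡ-≈ (-‿inverseʳ 1#) (<-respʳ-≈ (+-identityˡ (- 1#))
               (+-monoˡ-< (- 1#) 1<0))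

    square-mono-< : ∀ {x y} → 0# < x → x < y → x * x < y * y
    square-mono-< {x} {y} 0<x x<y =
      <-respˡ-≈ (+-identityˡ (x * x))
        (<-respʳ-≈ (eq x y) (+-monoˡ-< (x * x) (*-pos 0<y-x 0<y+x)))
      where
      eq : ∀ x y → (y + - x) * (y + x) + x * x ≈ y * y
      eq = solve 2 (λ x y →
        (y :+ :- x) :* (y :+ x) :+ x :* x := y :* y) refl
      0<y-x : 0# < y + - x
      0<y-x = <-respˡ-≈ (-‿inverseʳ x) (+-monoˡ-< (- x) x<y)
      0<y+x : 0# < y + x
      0<y+x = <-trans 0<x (<-respˡ-≈ (+-identityˡ x)
                (+-monoˡ-< x (<-trans 0<x x<y)))

    half : Carrier
    half = proj₁ (#⇒invertible {1# + 1#} {0#}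
             (inj₂ (<-trans 0<1 (<-respˡ-≈ (+-identityʳ 1#) (+-monoʳ-< 1# 0<1)))))

    half+half : half + half ≈ 1#
    half+half = trans (eq half) (proj₁ (proj₂ (#⇒invertible {1# + 1#} {0#}
             (inj₂ (<-trans 0<1 (<-respˡ-≈ (+-identityʳ 1#) (+-monoʳ-< 1# 0<1)))))))
      where
      eq : ∀ h → h + h ≈ h * (1# + 1# + - 0#)
      eq = solve 1 (λ h →
        h :+ h := h :* (con (+ 1) :+ con (+ 1) :+ :- con (+ 0))) refl

    0<half : 0# < half
    0<half with <-cotrans 0<1 half
    ... | inj₁ 0<h = 0<h
    ... | inj₂ h<1 = <-respˡ-≈ (-‿inverseʳ half)
            (<-respʳ-≈ (trans (+-congʳ (sym half+half)) (-‿cancel half half))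
              (+-monoˡ-< (- half) h<1))

    mid : Carrier → Carrier → Carrier
    mid x y = x + half * (y + - x)

    x<mid : ∀ {x y} → x < y → x < mid x y
    x<mid {x} {y} x<y = <-respˡ-≈ (+-identityʳ x) (+-monoʳ-< x
      (*-pos 0<half (<-respˡ-≈ (-‿inverseʳ x) (+-monoˡ-< (- x) x<y))))

    mid<y : ∀ {x y} → x < y → mid x y < y
    mid<y {x} {y} x<y = <-respˡ-≈ (+-identityʳ (mid x y)) (<-respʳ-≈
      (trans (eq x y half) (trans (+-congˡ (*-congʳ half+half)) (eq′ x y)))
      (+-monoʳ-< (mid x y)
        (*-pos 0<half (<-respˡ-≈ (-‿inverseʳ x) (+-monoˡ-< (- x) x<y)))))
      where
      eq : ∀ x y h → x + h * (y + - x) + h * (y + - x) ≈ x + (h + h) * (y + - x)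
      eq = solve 3 (λ x y h →
        x :+ h :* (y :+ :- x) :+ h :* (y :+ :- x) := x :+ (h :+ h) :* (y :+ :- x)) refl
      eq′ : ∀ x y → x + 1# * (y + - x) ≈ y
      eq′ = solve 2 (λ x y →
        x :+ con (+ 1) :* (y :+ :- x) := y) refl

    between : ∀ {x y} → x < y → 0# < y → ∃[ m ] (0# < m × x < m × m < y)
    between {x} {y} x<y 0<y with <-cotrans (x<mid x<y) (mid 0# y)
    ... | inj₁ x<m = mid 0# y , x<mid 0<y , x<m , mid<y 0<y
    ... | inj₂ m<m′ = mid x y , <-trans (x<mid 0<y) m<m′ , x<mid x<y , mid<y x<y

  Below√ : Carrier → Pred Carrier ℓ
  Below√ a y = (y ≤ 0#) ⊎ (y * y ≤ a)

  private
    square-bound : ∀ {a y} → 0# < y → a < y * y → UpperBound (Below√ a) y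
    square-bound 0<y a<y² (inj₁ p≤0)  y<p = p≤0 (<-trans 0<y y<p)
    square-bound 0<y a<y² (inj₂ p²≤a) y<p =
      p²≤a (<-trans a<y² (square-mono-< 0<y y<p))

    below√-satisfiable : ∀ a → Satisfiable (Below√ a)
    below√-satisfiable a = 0# , inj₁ (<-irrefl refl)

    below√-bounded : ∀ a → ∃ (UpperBound (Below√ a))
    below√-bounded a with <-cotrans 0<1 a
    ... | inj₂ a<1 = 1# , square-bound 0<1 (<-respʳ-≈ (sym (*-identityˡ 1#)) a<1)
    ... | inj₁ 0<a = 1# + a , square-bound 0<1+a
            (<-respˡ-≈ (+-identityˡ a) (<-respʳ-≈ (eq a)
              (+-monoˡ-< a (<-trans 0<1 (<-respˡ-≈ (+-identityʳ 1#)
                (+-monoʳ-< 1# 0<a+a²))))))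
      where
      0<1+a : 0# < 1# + a
      0<1+a = <-trans 0<1 (<-respˡ-≈ (+-identityʳ 1#) (+-monoʳ-< 1# 0<a))
      0<a+a² : 0# < a + a * a
      0<a+a² = <-trans 0<a (<-respˡ-≈ (+-identityʳ a) (+-monoʳ-< a (*-pos 0<a 0<a)))
      eq : ∀ a → 1# + (a + a * a) + a ≈ (1# + a) * (1# + a)
      eq = solve 1 (λ a →
        con (+ 1) :+ (a :+ a :* a) :+ a := (con (+ 1) :+ a) :* (con (+ 1) :+ a)) refl

    below√-located : ∀ a → Located (Below√ a)
    below√-located a {x} {y} x<y with <-cotrans x<y 0#
    ... | inj₁ x<0 = inj₂ (0# , inj₁ (<-irrefl refl) , x<0)
    ... | inj₂ 0<y with between x<y 0<y
    ...   | m , 0<m , x<m , m<y with <-cotrans (square-mono-< 0<m m<y) a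
    ...     | inj₁ m²<a = inj₂ (m , inj₂ (<-asym m²<a) , x<m)
    ...     | inj₂ a<y² = inj₁ (square-bound 0<y a<y²)

  -- The nonnegative square root of a when 0 ≤ a; it is 0 when a < 0,
  -- which is why Below√ a contains every y ≤ 0.
  √-sup : ∀ a → ∃ (IsSup (Below√ a))
  √-sup a = sup (Below√ a) (below√-satisfiable a) (below√-bounded a)
              (below√-located a)

  √_ : Carrier → Carrier
  √ a = proj₁ (√-sup a)

-- x + iy is represented by the pair (x , y).
module Complex {c ℓ} (ℝ : Reals c ℓ) where
  open Reals ℝ
  open SquareRoot ℝ

  open IntegerRingSolver commutativeRing

  infix  8 -ℂ_
  infixl 7 _*ℂ_
  infixl 6 _+ℂ_
  infix  4 _≈ℂ_

  ℂ : Set c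
  ℂ = Carrier × Carrier

  _≈ℂ_ : Rel ℂ ℓ
  (x , y) ≈ℂ (u , v) = x ≈ u × y ≈ v

  _+ℂ_ _*ℂ_ : Op₂ ℂ
  (x , y) +ℂ (u , v) = x + u , y + v
  (x , y) *ℂ (u , v) = x * u + - (y * v) , x * v + y * u

  -ℂ_ : Op₁ ℂ
  -ℂ (x , y) = - x , - y

  fromℝ : Carrier → ℂ
  fromℝ x = x , 0#

  0ℂ 1ℂ : ℂ
  0ℂ = fromℝ 0#
  1ℂ = fromℝ 1#

  ∣_∣ : ℂ → Carrier
  ∣ x , y ∣ = √ (x * x + y * y)

  ℂ-commutativeRing : CommutativeRing c ℓ
  ℂ-commutativeRing = record
    { Carrier = ℂ ; _≈_ = _≈ℂ_ ; _+_ = _+ℂ_ ; _*_ = _*ℂ_ ; -_ = -ℂ_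
    ; 0# = 0ℂ ; 1# = 1ℂ
    ; isCommutativeRing = record
      { isRing = record
        { +-isAbelianGroup = record
          { isGroup = record
            { isMonoid = record
              { isSemigroup = record
                { isMagma = record
                  { isEquivalence = record
                    { refl  = refl , refl
                    ; sym   = λ (p , q) → sym p , sym q
                    ; trans = λ (p , q) (r , s) → trans p r , trans q s
                    }
                  ; ∙-cong = λ (p , q) (r , s) → +-cong p r , +-cong q s
                  }
                ; assoc = λ (x , y) (u , v) (w , z) → +-assoc x u w , +-assoc y v z
                }
              ; identity = (λ (x , y) → +-identityˡ x , +-identityˡ y)
                         , (λ (x , y) → +-identityʳ x , +-identityʳ y)
              }
            ; inverse = (λ (x , y) → -‿inverseˡ x , -‿inverseˡ y)
                      , (λ (x , y) → -‿inverseʳ x , -‿inverseʳ y)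
            ; ⁻¹-cong = λ (p , q) → -‿cong p , -‿cong q
            }
          ; comm = λ (x , y) (u , v) → +-comm x u , +-comm y v
          }
        ; *-cong = λ (p , q) (r , s) →
            +-cong (*-cong p r) (-‿cong (*-cong q s)) ,
            +-cong (*-cong p s) (*-cong q r)
        ; *-assoc = λ (x , y) (u , v) (w , z) →
            assocʳᵉ x y u v w z , assocⁱᵐ x y u v w z
        ; *-identity = (λ (x , y) → 1ˡʳᵉ x y , 1ˡⁱᵐ x y)
                     , (λ (x , y) → 1ʳʳᵉ x y , 1ʳⁱᵐ x y)
        ; distrib = (λ (x , y) (u , v) (w , z) →
                       distˡʳᵉ x y u v w z , distˡⁱᵐ x y u v w z)
                  , (λ (x , y) (u , v) (w , z) →
                       distʳʳᵉ x y u v w z , distʳⁱᵐ x y u v w z)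
        }
      ; *-comm = λ (x , y) (u , v) → commʳᵉ x y u v , commⁱᵐ x y u v
      }
    }
    where
    assocʳᵉ : ∀ x y u v w z →
      (x * u + - (y * v)) * w + - ((x * v + y * u) * z) ≈
      x * (u * w + - (v * z)) + - (y * (u * z + v * w))
    assocʳᵉ = solve 6 (λ x y u v w z →
      (x :* u :+ :- (y :* v)) :* w :+ :- ((x :* v :+ y :* u) :* z) := x :* (u :* w :+ :- (v :* z)) :+ :- (y :* (u :* z :+ v :* w))) refl
    assocⁱᵐ : ∀ x y u v w z →
      (x * u + - (y * v)) * z + (x * v + y * u) * w ≈
      x * (u * z + v * w) + y * (u * w + - (v * z))
    assocⁱᵐ = solve 6 (λ x y u v w z →
      (x :* u :+ :- (y :* v)) :* z :+ (x :* v :+ y :* u) :* w := x :* (u :* z :+ v :* w) :+ y :* (u :* w :+ :- (v :* z))) refl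
    1ˡʳᵉ : ∀ x y → 1# * x + - (0# * y) ≈ x
    1ˡʳᵉ = solve 2 (λ x y →
      con (+ 1) :* x :+ :- (con (+ 0) :* y) := x) refl
    1ˡⁱᵐ : ∀ x y → 1# * y + 0# * x ≈ y
    1ˡⁱᵐ = solve 2 (λ x y →
      con (+ 1) :* y :+ con (+ 0) :* x := y) refl
    1ʳʳᵉ : ∀ x y → x * 1# + - (y * 0#) ≈ x
    1ʳʳᵉ = solve 2 (λ x y →
      x :* con (+ 1) :+ :- (y :* con (+ 0)) := x) refl
    1ʳⁱᵐ : ∀ x y → x * 0# + y * 1# ≈ y
    1ʳⁱᵐ = solve 2 (λ x y →
      x :* con (+ 0) :+ y :* con (+ 1) := y) refl
    distˡʳᵉ : ∀ x y u v w z →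
      x * (u + w) + - (y * (v + z)) ≈
      (x * u + - (y * v)) + (x * w + - (y * z))
    distˡʳᵉ = solve 6 (λ x y u v w z →
      x :* (u :+ w) :+ :- (y :* (v :+ z)) := (x :* u :+ :- (y :* v)) :+ (x :* w :+ :- (y :* z))) refl
    distˡⁱᵐ : ∀ x y u v w z →
      x * (v + z) + y * (u + w) ≈ (x * v + y * u) + (x * z + y * w)
    distˡⁱᵐ = solve 6 (λ x y u v w z →
      x :* (v :+ z) :+ y :* (u :+ w) := (x :* v :+ y :* u) :+ (x :* z :+ y :* w)) refl
    distʳʳᵉ : ∀ x y u v w z →
      (u + w) * x + - ((v + z) * y) ≈
      (u * x + - (v * y)) + (w * x + - (z * y))
    distʳʳᵉ = solve 6 (λ x y u v w z →
      (u :+ w) :* x :+ :- ((v :+ z) :* y) := (u :* x :+ :- (v :* y)) :+ (w :* x :+ :- (z :* y))) refl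
    distʳⁱᵐ : ∀ x y u v w z →
      (u + w) * y + (v + z) * x ≈ (u * y + v * x) + (w * y + z * x)
    distʳⁱᵐ = solve 6 (λ x y u v w z →
      (u :+ w) :* y :+ (v :+ z) :* x := (u :* y :+ v :* x) :+ (w :* y :+ z :* x)) refl
    commʳᵉ : ∀ x y u v → x * u + - (y * v) ≈ u * x + - (v * y)
    commʳᵉ = solve 4 (λ x y u v →
      x :* u :+ :- (y :* v) := u :* x :+ :- (v :* y)) refl
    commⁱᵐ : ∀ x y u v → x * v + y * u ≈ u * y + v * x
    commⁱᵐ = solve 4 (λ x y u v →
      x :* v :+ y :* u := u :* y :+ v :* x) refl

Matrix : ∀ {a} → Set a → ℕ → Set a
Matrix X n = Vector (Vector X n) n

module Determinant {c ℓ} (R : CommutativeRing c ℓ) where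
  open CommutativeRing R hiding (zero)
  open Sum +-commutativeMonoid using (sum)

  -- (-1)^k x
  alternate : ∀ {n} → Fin n → Carrier → Carrier
  alternate zero    x = x
  alternate (suc k) x = - alternate k x

  minor : ∀ {n} → Matrix Carrier (suc n) → Fin (suc n) → Matrix Carrier n
  minor M j i k = M (suc i) (punchIn j k)

  -- Laplace expansion along the first row.
  det : ∀ {n} → Matrix Carrier n → Carrier
  det {zero}  M = 1#
  det {suc n} M = sum λ j → alternate j (M zero j * det (minor M j))

module RealMatrices {c ℓ} (ℝ : Reals c ℓ) where
  open Reals ℝ public
  open SquareRoot ℝ public using (√_)
  open Complex ℝ public
  open Sum +-commutativeMonoid public using (sum)
  open RawMonoidDefs +-rawMonoid public using () renaming (_×_ to _·_)

  private
    module ℂR = CommutativeRing ℂ-commutativeRing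

  open Determinant ℂ-commutativeRing public using (det)
  open Sum ℂR.*-commutativeMonoid public using () renaming (sum to product)

  infix 4 _≋_
  infixl 6 _⊖_

  _≋_ : ∀ {n} → Rel (Matrix Carrier n) ℓ
  A ≋ B = ∀ i j → A i j ≈ B i j

  _⊖_ : ∀ {n} → Op₂ (Matrix Carrier n)
  (A ⊖ B) i j = A i j + - B i j

  rowSum columnSum : ∀ {n} → Matrix Carrier n → Vector Carrier n
  rowSum    A i = sum λ j → A i j
  columnSum A j = sum λ i → A i j

  IsStochastic : ∀ {n} → Matrix Carrier n → Set ℓ
  IsStochastic A = (∀ i j → 0# ≤ A i j) × (∀ i → rowSum A i ≈ 1#)

  IsDoublyStochastic : ∀ {n} → Matrix Carrier n → Set ℓ
  IsDoublyStochastic A = IsStochastic A × (∀ j → columnSum A j ≈ 1#)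

  IsSmallestEntry : ∀ {n} → Vector Carrier n → Carrier → Set ℓ
  IsSmallestEntry v a = (∃[ i ] a ≈ v i) × (∀ i → a ≤ v i)

  _I-_ : ∀ {n} → ℂ → Matrix Carrier n → Matrix ℂ n
  (z I- A) i j = (if does (i ≟ j) then z else 0ℂ) +ℂ (-ℂ fromℝ (A i j))

  charPoly : ∀ {n} → Matrix Carrier n → ℂ → ℂ
  charPoly A z = det (z I- A)

  -- μ lists the roots of the characteristic polynomial with multiplicity:
  -- det (zI - A) = ∏ᵢ (z - μᵢ).  As ℂ is infinite, equality of the values
  -- at all z is equality of polynomials.  The order of μ is immaterial.
  IsSpectrum : ∀ {n} → Matrix Carrier n → Vector ℂ n → Set (c ⊔ ℓ)
  IsSpectrum A μ = ∀ z → charPoly A z ≈ℂ product (λ i → z +ℂ -ℂ μ i)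

  -- The spectrum is (ρ; λ₂, …, λₙ): the first entry is the Perron
  -- eigenvalue, that is, ρ is the spectral radius.
  IsPerronSpectrum : ∀ {m} → Matrix Carrier (suc m) →
                     Carrier → Vector ℂ m → Set (c ⊔ ℓ)
  IsPerronSpectrum A ρ λs =
    IsSpectrum A σ × (∀ i → ∣ σ i ∣ ≤ ρ)
    where σ = fromℝ ρ Vector.∷ λs

  Cospectral : ∀ {n} → Rel (Matrix Carrier n) (c ⊔ ℓ)
  Cospectral A B = ∀ μ → IsSpectrum A μ ⇔ IsSpectrum B μ

  frobeniusNorm : ∀ {n} → Matrix Carrier n → Carrier
  frobeniusNorm X = √ (sum λ i → sum λ j → X i j * X i j)

  IsClosestDoublyStochastic : ∀ {n} → Rel (Matrix Carrier n) (c ⊔ ℓ)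
  IsClosestDoublyStochastic A B =
    IsDoublyStochastic B ×
    (∀ C → IsDoublyStochastic C →
      frobeniusNorm (A ⊖ B) ≤ frobeniusNorm (A ⊖ C))

  IsUniqueClosestDoublyStochastic : ∀ {n} → Rel (Matrix Carrier n) (c ⊔ ℓ)
  IsUniqueClosestDoublyStochastic A B =
    IsClosestDoublyStochastic A B ×
    (∀ C → IsClosestDoublyStochastic A C → C ≋ B)

-- Let B be A with (1 − s_j)/n added to every entry of column j.  Its column sums are 1,
-- its row sums are unchanged because the s_j add up to n, and its entries are nonnegative
-- exactly by s_j ≤ 1 + n a_j.  Adding all columns of zI − A to the first makes that column
-- constant z − 1; subtracting multiples of it from the others then turns zI − A into
-- zI − B, so the characteristic polynomials agree.  Finally B − A is constant along columns,
-- hence orthogonal to B − C for every doubly stochastic C, and Pythagoras gives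
-- ‖A − C‖² = ‖A − B‖² + ‖B − C‖².

{-# OPTIONS --safe #-}
module Submission where

open import Defs
open import Data.Nat.Base using (ℕ; suc)
open import Data.Product.Base using (_×_; ∃-syntax)
open import Data.Vec.Functional using (Vector)

open import Algebra.Apartness.Structures using (IsHeytingField)
open import Algebra.Bundles using (CommutativeRing)
import Algebra.Properties.CommutativeMonoid.Sum as Sum
import Algebra.Properties.Ring as RingProperties
import Algebra.Properties.Semiring.Mult as Mult
import Algebra.Properties.Semiring.Sum as SemiringSum
open import Data.Bool.Base using (if_then_else_)
open import Data.Fin.Base as Fin using (Fin; zero; suc; inject₁; punchIn; punchOut)
open import Data.Fin.Induction using (<-weakInduction)
open import Data.Fin.Properties
  using (_≟_; toℕ-inject₁; punchInᵢ≢i; punchIn-punchOut; punchIn-injective; ≤∧≢⇒<)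
open import Data.Integer.Base using (+_)
open import Data.Nat.Base as ℕ using (zero; z≤n; s≤s)
import Data.Nat.Properties as ℕₚ
open import Data.Product.Base using (_,_; proj₁; proj₂)
open import Data.Sum.Base using (_⊎_; inj₁; inj₂)
open import Data.Vec.Functional using (_∷_; head; tail; updateAt)
open import Data.Vec.Functional.Properties using (updateAt-updates; updateAt-minimal)
open import Function.Base using (_∘_; const)
open import Function.Bundles using (mk⇔)
open import Relation.Binary.PropositionalEquality.Core as ≡ using (_≡_; _≢_)
open import Relation.Nullary.Decidable.Core using (does; yes; no)
open import Relation.Nullary.Negation.Core using (contradiction)

-- Deleting an index next to, or away from, an adjacent pair.

-- Columns that are adjacent in a matrix stay adjacent in a minor that keeps both, so an induction
-- over minors can go on.
punchIn-adjacent : ∀ {n} (j : Fin (suc (suc n))) (k : Fin (suc n)) →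
  j ≢ inject₁ k → j ≢ suc k →
  ∃[ l ] (punchIn j (inject₁ l) ≡ inject₁ k × punchIn j (suc l) ≡ suc k)
punchIn-adjacent zero zero j≢k _ = contradiction ≡.refl j≢k
punchIn-adjacent zero (suc k) _ _ = k , ≡.refl , ≡.refl
punchIn-adjacent (suc zero) zero _ j≢1+k = contradiction ≡.refl j≢1+k
punchIn-adjacent {suc n} (suc (suc j)) zero _ _ = zero , ≡.refl , ≡.refl
punchIn-adjacent {suc n} (suc j) (suc k) j≢k j≢1+k
  with l , eq , eq′ ← punchIn-adjacent j k (j≢k ∘ ≡.cong suc) (j≢1+k ∘ ≡.cong suc)
  = suc l , ≡.cong suc eq , ≡.cong suc eq′

-- Skipping `inject₁ k` and skipping `suc k` give the same enumeration except at `k`. The next two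
-- lemmas treat `k`, where each yields the index skipped by the other.
punchIn-inject₁≡punchIn-suc : ∀ {n} (k l : Fin n) → l ≢ k →
  punchIn (inject₁ k) l ≡ punchIn (suc k) l
punchIn-inject₁≡punchIn-suc zero zero l≢k = contradiction ≡.refl l≢k
punchIn-inject₁≡punchIn-suc zero (suc l) _ = ≡.refl
punchIn-inject₁≡punchIn-suc (suc k) zero _ = ≡.refl
punchIn-inject₁≡punchIn-suc (suc k) (suc l) l≢k =
  ≡.cong suc (punchIn-inject₁≡punchIn-suc k l (l≢k ∘ ≡.cong suc))

punchIn-inject₁-self : ∀ {n} (k : Fin n) → punchIn (inject₁ k) k ≡ suc k
punchIn-inject₁-self zero = ≡.refl
punchIn-inject₁-self (suc k) = ≡.cong suc (punchIn-inject₁-self k)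

punchIn-suc-self : ∀ {n} (k : Fin n) → punchIn (suc k) k ≡ inject₁ k
punchIn-suc-self zero = ≡.refl
punchIn-suc-self (suc k) = ≡.cong suc (punchIn-suc-self k)

-- Determinants over a commutative ring: multilinear and alternating in the columns, column
-- operations.

module DeterminantProperties {c ℓ} (R : CommutativeRing c ℓ) where
  open CommutativeRing R hiding (zero)
  open RingProperties ring using (-0#≈0#)
  open Sum +-commutativeMonoid
  open SemiringSum semiring using (*-distribˡ-sum)
  open Determinant R
  open IntegerRingSolver R
  open import Relation.Binary.Reasoning.Setoid setoid

  -- Moves from `s` to `t` one coordinate at a time. Congruence is a hypothesis because vectors are
  -- functions, and `head t ∷ tail t` agrees with `t` only pointwise.
  coordinatewise-constant : ∀ {n} (f : Vector Carrier n → Carrier) →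
    (∀ s t → (∀ j → s j ≈ t j) → f s ≈ f t) →
    (∀ k s t → (∀ j → j ≢ k → s j ≈ t j) → f s ≈ f t) →
    ∀ s t → f s ≈ f t
  coordinatewise-constant {zero} f f-cong _ s t = f-cong s t λ ()
  coordinatewise-constant {suc n} f f-cong f-indep s t = begin
    f s                    ≈⟨ f-indep zero s (head t ∷ tail s) (λ where
                                zero    0≢0 → contradiction ≡.refl 0≢0
                                (suc j) _   → refl) ⟩
    f (head t ∷ tail s)    ≈⟨ coordinatewise-constant (λ r → f (head t ∷ r))
                                (λ r r′ r≈r′ → f-cong _ _ λ where
                                  zero    → refl
                                  (suc j) → r≈r′ j)
                                (λ k r r′ r≈r′ → f-indep (suc k) _ _ λ where
                                  zero    _   → refl
                                  (suc j) j≢k → r≈r′ j (j≢k ∘ ≡.cong suc))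
                                (tail s) (tail t) ⟩
    f (head t ∷ tail t)    ≈⟨ f-cong _ _ (λ where
                                zero    → refl
                                (suc j) → refl) ⟩
    f t                    ∎

  sum-zero : ∀ {n} (f : Vector Carrier n) → (∀ j → f j ≈ 0#) → sum f ≈ 0#
  sum-zero {n} f f≈0 = trans (sum-cong-≋ f≈0) (sum-replicate-zero n)

  -- The shape of a Laplace expansion with two equal adjacent columns: two opposite terms, all
  -- others zero.
  sum-adjacent-cancel : ∀ {n} (k : Fin n) (f : Vector Carrier (suc n)) →
    f (inject₁ k) + f (suc k) ≈ 0# →
    (∀ j → j ≢ inject₁ k → j ≢ suc k → f j ≈ 0#) → sum f ≈ 0#
  sum-adjacent-cancel zero f cancel rest = begin
    f zero + (f (suc zero) + sum (tail (tail f)))  ≈⟨ +-assoc _ _ _ ⟨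
    f zero + f (suc zero) + sum (tail (tail f))    ≈⟨ +-cong cancel
                                                       (sum-zero (tail (tail f)) λ j → rest (suc (suc j)) (λ ()) (λ ())) ⟩
    0# + 0#                                        ≈⟨ +-identityˡ 0# ⟩
    0#                                             ∎
  sum-adjacent-cancel (suc k) f cancel rest = begin
    f zero + sum (tail f)  ≈⟨ +-cong (rest zero (λ ()) (λ ()))
                                (sum-adjacent-cancel k (tail f) cancel λ j j≢k j≢1+k →
                                  rest (suc j) (λ where ≡.refl → j≢k ≡.refl)
                                               (λ where ≡.refl → j≢1+k ≡.refl)) ⟩
    0# + 0#                ≈⟨ +-identityˡ 0# ⟩
    0#                     ∎

  alternate-cong : ∀ {n} (k : Fin n) {x y} → x ≈ y → alternate k x ≈ alternate k y
  alternate-cong zero    x≈y = x≈y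
  alternate-cong (suc k) x≈y = -‿cong (alternate-cong k x≈y)

  alternate-inject₁ : ∀ {n} (k : Fin n) x → alternate (inject₁ k) x ≡ alternate k x
  alternate-inject₁ zero    x = ≡.refl
  alternate-inject₁ (suc k) x = ≡.cong -_ (alternate-inject₁ k x)

  alternate-linear : ∀ {n} (k : Fin n) s t x y →
    alternate k (s * x + t * y) ≈ s * alternate k x + t * alternate k y
  alternate-linear zero    s t x y = refl
  alternate-linear (suc k) s t x y = trans (-‿cong (alternate-linear k s t x y))
    (solve 4 (λ s t x y → :- (s :* x :+ t :* y) := s :* :- x :+ t :* :- y) refl
      s t (alternate k x) (alternate k y))

  alternate-0 : ∀ {n} (k : Fin n) {x} → x ≈ 0# → alternate k x ≈ 0#
  alternate-0 zero    x≈0 = x≈0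
  alternate-0 (suc k) x≈0 = trans (-‿cong (alternate-0 k x≈0)) -0#≈0#

  det-cong : ∀ {n} (A B : Matrix Carrier n) → (∀ i j → A i j ≈ B i j) → det A ≈ det B
  det-cong {zero}  A B _   = refl
  det-cong {suc n} A B A≈B = sum-cong-≋ λ j → alternate-cong j
    (*-cong (A≈B zero j) (det-cong (minor A j) (minor B j) λ i k → A≈B (suc i) (punchIn j k)))

  -- Induction along the Laplace expansion. In term `k` the entry is linear and the minor omits the
  -- column; in any other term the entry is fixed and the minor is linear in the surviving copy of
  -- column `k`, at position `punchOut j≢k`.
  det-column-linear : ∀ {n} (k : Fin n) (A B C : Matrix Carrier n) s t →
    (∀ i j → j ≢ k → A i j ≈ C i j) → (∀ i j → j ≢ k → B i j ≈ C i j) →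
    (∀ i → C i k ≈ s * A i k + t * B i k) →
    det C ≈ s * det A + t * det B
  det-column-linear {suc n} k A B C s t A≈C B≈C C≈sA+tB = begin
    sum (term C)                                           ≈⟨ sum-cong-≋ step ⟩
    sum (λ j → s * term A j + t * term B j)                ≈⟨ ∑-distrib-+ (λ j → s * term A j) (λ j → t * term B j) ⟩
    sum (λ j → s * term A j) + sum (λ j → t * term B j)
      ≈⟨ +-cong (*-distribˡ-sum s (term A)) (*-distribˡ-sum t (term B)) ⟨
    s * sum (term A) + t * sum (term B)                    ∎
    where
    term : Matrix Carrier (suc n) → Vector Carrier (suc n)
    term M j = alternate j (M zero j * det (minor M j))

    summand : ∀ j → C zero j * det (minor C j) ≈
      s * (A zero j * det (minor A j)) + t * (B zero j * det (minor B j))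
    summand j with j ≟ k
    ... | yes ≡.refl = begin
      C zero j * det (minor C j)
        ≈⟨ *-congʳ (C≈sA+tB zero) ⟩
      (s * A zero j + t * B zero j) * det (minor C j)
        ≈⟨ solve 5 (λ s t a b d → (s :* a :+ t :* b) :* d := s :* (a :* d) :+ t :* (b :* d))
             refl s t (A zero j) (B zero j) (det (minor C j)) ⟩
      s * (A zero j * det (minor C j)) + t * (B zero j * det (minor C j))
        ≈⟨ +-cong (*-congˡ (*-congˡ (det-cong (minor A j) (minor C j) λ i l → A≈C _ _ (punchInᵢ≢i j l))))
                  (*-congˡ (*-congˡ (det-cong (minor B j) (minor C j) λ i l → B≈C _ _ (punchInᵢ≢i j l)))) ⟨
      s * (A zero j * det (minor A j)) + t * (B zero j * det (minor B j)) ∎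
    ... | no j≢k = begin
      C zero j * det (minor C j)
        ≈⟨ *-congˡ (det-column-linear k′ (minor A j) (minor B j) (minor C j) s t
             (λ i l l≢k′ → A≈C _ _ (off l l≢k′))
             (λ i l l≢k′ → B≈C _ _ (off l l≢k′))
             (λ i → ≡.subst (λ l → C (suc i) l ≈ s * A (suc i) l + t * B (suc i) l)
                      (≡.sym (punchIn-punchOut j≢k)) (C≈sA+tB (suc i)))) ⟩
      C zero j * (s * det (minor A j) + t * det (minor B j))
        ≈⟨ solve 5 (λ c s t a b → c :* (s :* a :+ t :* b) := s :* (c :* a) :+ t :* (c :* b))
             refl (C zero j) s t (det (minor A j)) (det (minor B j)) ⟩
      s * (C zero j * det (minor A j)) + t * (C zero j * det (minor B j))
        ≈⟨ +-cong (*-congˡ (*-congʳ (A≈C zero j j≢k))) (*-congˡ (*-congʳ (B≈C zero j j≢k))) ⟨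
      s * (A zero j * det (minor A j)) + t * (B zero j * det (minor B j)) ∎
      where
      k′ = punchOut j≢k
      off : ∀ l → l ≢ k′ → punchIn j l ≢ k
      off l l≢k′ eq = l≢k′ (punchIn-injective j l k′ (≡.trans eq (≡.sym (punchIn-punchOut j≢k))))

    step : ∀ j → term C j ≈ s * term A j + t * term B j
    step j = trans (alternate-cong j (summand j)) (alternate-linear j s t _ _)

  -- The two terms that delete one of the equal columns have equal entries and minors but opposite
  -- signs; every other minor still contains both columns, adjacent, and vanishes by induction.
  det-adjacent-columns : ∀ {n} (k : Fin n) (M : Matrix Carrier (suc n)) →
    (∀ i → M i (inject₁ k) ≈ M i (suc k)) → det M ≈ 0#
  det-adjacent-columns {suc n} k M M≈ = sum-adjacent-cancel k _ cancel rest
    where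
    minors : ∀ i l → minor M (inject₁ k) i l ≈ minor M (suc k) i l
    minors i l with l ≟ k
    ... | no l≢k = reflexive (≡.cong (M (suc i)) (punchIn-inject₁≡punchIn-suc k l l≢k))
    ... | yes ≡.refl = begin
      M (suc i) (punchIn (inject₁ k) k)  ≡⟨ ≡.cong (M (suc i)) (punchIn-inject₁-self k) ⟩
      M (suc i) (suc k)                  ≈⟨ M≈ (suc i) ⟨
      M (suc i) (inject₁ k)              ≡⟨ ≡.cong (M (suc i)) (punchIn-suc-self k) ⟨
      M (suc i) (punchIn (suc k) k)      ∎

    cancel : alternate (inject₁ k) (M zero (inject₁ k) * det (minor M (inject₁ k))) +
             alternate (suc k) (M zero (suc k) * det (minor M (suc k))) ≈ 0#
    cancel = trans (+-congʳ (trans (reflexive (alternate-inject₁ k _))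
               (alternate-cong k (*-cong (M≈ zero)
                 (det-cong (minor M (inject₁ k)) (minor M (suc k)) minors)))))
               (-‿inverseʳ _)

    rest : ∀ j → j ≢ inject₁ k → j ≢ suc k → alternate j (M zero j * det (minor M j)) ≈ 0#
    rest j j≢k j≢1+k with l , eq , eq′ ← punchIn-adjacent j k j≢k j≢1+k =
      alternate-0 j (trans (*-congˡ (det-adjacent-columns l (minor M j) λ i →
        ≡.subst₂ (λ p q → M (suc i) p ≈ M (suc i) q) (≡.sym eq) (≡.sym eq′) (M≈ (suc i))))
        (zeroʳ _))

  setColumn : ∀ {n} → Matrix Carrier n → Fin n → Vector Carrier n → Matrix Carrier n
  setColumn M k v i = updateAt (M i) k (const (v i))

  setColumn-at : ∀ {n} (M : Matrix Carrier n) k v i → setColumn M k v i k ≈ v i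
  setColumn-at M k v i = reflexive (updateAt-updates k (M i))

  setColumn-off : ∀ {n} (M : Matrix Carrier n) k v i j → j ≢ k → setColumn M k v i j ≈ M i j
  setColumn-off M k v i j j≢k = reflexive (updateAt-minimal j k (M i) j≢k)

  -- Let v be the repeated column and w the column just before its second copy.
  -- Replacing both by w + v gives determinant 0; expanding that by linearity leaves
  -- det M, a determinant with adjacent columns w, and one where the copies of v are closer.
  det-equal-columns : ∀ {n} (M : Matrix Carrier n) (k l : Fin n) → k Fin.< l →
    (∀ i → M i k ≈ M i l) → det M ≈ 0#
  -- Induction on the right-hand column; at index zero no column lies to its left.
  det-equal-columns {suc n} M k l = <-weakInduction P (λ _ _ ()) step l M k
    where
    P : Fin (suc n) → Set _
    P l = ∀ M k → k Fin.< l → (∀ i → M i k ≈ M i l) → det M ≈ 0#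

    step : ∀ l → P (inject₁ l) → P (suc l)
    step l ih M k (s≤s k≤l) Mk≈Ml with k ≟ inject₁ l
    ... | yes ≡.refl = det-adjacent-columns l M Mk≈Ml
    ... | no k≢q = begin
      det M
        ≈⟨ solve 1 (λ d → d :=
             con (+ 1) :* (con (+ 1) :* con (+ 0) :+ con (+ 1) :* d) :+ con (+ 1) :* con (+ 0))
             refl (det M) ⟩
      1# * (1# * 0# + 1# * det M) + 1# * 0#
        ≈⟨ +-cong (*-congˡ (+-congʳ (*-congˡ det-ww))) (*-congˡ det-vwv) ⟨
      1# * (1# * det ww + 1# * det M) + 1# * det vwv
        ≈⟨ +-congʳ (*-congˡ linear-l) ⟨
      1# * det wwv + 1# * det vwv
        ≈⟨ linear-q ⟨
      det both
        ≈⟨ det-both ⟩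
      0# ∎
      where
      q = inject₁ l
      w v w+v : Vector Carrier (suc n)
      w i = M i q
      v i = M i (suc l)
      w+v i = w i + v i

      -- Columns `q` and `suc l` of these are, in order: `w`, `w`; `w`, `w+v`; `v`, `w+v`; `w+v`,
      -- `w+v`.
      ww wwv vwv both : Matrix Carrier (suc n)
      ww   = setColumn M (suc l) w
      wwv  = setColumn M (suc l) w+v
      vwv  = setColumn wwv q v
      both = setColumn wwv q w+v

      q≢1+l : q ≢ suc l
      q≢1+l eq = ℕₚ.1+n≢n (≡.trans (≡.sym (≡.cong Fin.toℕ eq)) (toℕ-inject₁ l))

      k≢1+l : k ≢ suc l
      k≢1+l ≡.refl = ℕₚ.1+n≰n k≤l

      k<q : k Fin.< q
      k<q = ≤∧≢⇒< (≡.subst (Fin.toℕ k ℕ.≤_) (≡.sym (toℕ-inject₁ l)) k≤l) k≢q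

      det-ww : det ww ≈ 0#
      det-ww = det-adjacent-columns l ww λ i →
        trans (setColumn-off M (suc l) w i q q≢1+l) (sym (setColumn-at M (suc l) w i))

      det-vwv : det vwv ≈ 0#
      det-vwv = ih vwv k k<q λ i → begin
        vwv i k  ≈⟨ setColumn-off wwv q v i k k≢q ⟩
        wwv i k  ≈⟨ setColumn-off M (suc l) w+v i k k≢1+l ⟩
        M i k    ≈⟨ Mk≈Ml i ⟩
        v i      ≈⟨ setColumn-at wwv q v i ⟨
        vwv i q  ∎

      det-both : det both ≈ 0#
      det-both = det-adjacent-columns l both λ i → begin
        both i q        ≈⟨ setColumn-at wwv q w+v i ⟩
        w+v i           ≈⟨ setColumn-at M (suc l) w+v i ⟨
        wwv i (suc l)   ≈⟨ setColumn-off wwv q w+v i (suc l) (q≢1+l ∘ ≡.sym) ⟨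
        both i (suc l)  ∎

      linear-l : det wwv ≈ 1# * det ww + 1# * det M
      linear-l = det-column-linear (suc l) ww M wwv 1# 1#
        (λ i j j≢ → trans (setColumn-off M _ w i j j≢) (sym (setColumn-off M _ w+v i j j≢)))
        (λ i j j≢ → sym (setColumn-off M _ w+v i j j≢))
        (λ i → trans (setColumn-at M (suc l) w+v i)
          (+-cong (trans (sym (setColumn-at M (suc l) w i)) (sym (*-identityˡ _)))
                  (sym (*-identityˡ _))))

      linear-q : det both ≈ 1# * det wwv + 1# * det vwv
      linear-q = det-column-linear q wwv vwv both 1# 1#
        (λ i j j≢ → sym (setColumn-off wwv _ w+v i j j≢))
        (λ i j j≢ → trans (setColumn-off wwv _ v i j j≢) (sym (setColumn-off wwv _ w+v i j j≢)))
        (λ i → trans (setColumn-at wwv q w+v i)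
          (+-cong (trans (sym (setColumn-off M (suc l) w+v i q q≢1+l)) (sym (*-identityˡ _)))
                  (trans (sym (setColumn-at wwv q v i)) (sym (*-identityˡ _)))))

  det-column₀-linear : ∀ {m} (N : Fin (suc m) → Vector Carrier m) (u v w : Vector Carrier (suc m)) s t →
    (∀ i → w i ≈ s * u i + t * v i) →
    det (λ i → w i ∷ N i) ≈ s * det (λ i → u i ∷ N i) + t * det (λ i → v i ∷ N i)
  det-column₀-linear N u v w s t =
    det-column-linear zero (λ i → u i ∷ N i) (λ i → v i ∷ N i) (λ i → w i ∷ N i) s t
      (λ where
        i zero    0≢0 → contradiction ≡.refl 0≢0
        i (suc j) _   → refl)
      (λ where
        i zero    0≢0 → contradiction ≡.refl 0≢0
        i (suc j) _   → refl)

  det-columns-cong : ∀ {m} (M : Matrix Carrier (suc m)) (v : Vector Carrier (suc m))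
    (N : Fin (suc m) → Vector Carrier m) →
    (∀ i → M i zero ≈ v i) → (∀ i j → M i (suc j) ≈ N i j) →
    det M ≈ det (λ i → v i ∷ N i)
  det-columns-cong M v N M₀≈v M₊≈N = det-cong M (λ i → v i ∷ N i) λ where
    i zero    → M₀≈v i
    i (suc j) → M₊≈N i j

  -- Each summand contributes a determinant whose first column repeats a later one. An arbitrary
  -- selection `g` lets the induction peel off one column while `N` stays fixed.
  det-sum-column₀ : ∀ {m p} (v : Vector Carrier (suc m)) (N : Fin (suc m) → Vector Carrier m)
    (g : Fin p → Fin m) →
    det (λ i → (v i + sum (λ l → N i (g l))) ∷ N i) ≈ det (λ i → v i ∷ N i)
  det-sum-column₀ {p = zero} v N g =
    det-columns-cong (λ i → (v i + 0#) ∷ N i) v N (λ i → +-identityʳ (v i)) (λ i j → refl)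
  det-sum-column₀ {m} {suc p} v N g = begin
    det (λ i → (v i + (N i (g zero) + rest i)) ∷ N i)
      ≈⟨ det-column₀-linear N (λ i → v i + rest i) (λ i → N i (g zero))
           (λ i → v i + (N i (g zero) + rest i)) 1# 1#
           (λ i → solve 3 (λ v n r → v :+ (n :+ r) := con (+ 1) :* (v :+ r) :+ con (+ 1) :* n)
                    refl (v i) (N i (g zero)) (rest i)) ⟩
    1# * det (λ i → (v i + rest i) ∷ N i) + 1# * det (λ i → N i (g zero) ∷ N i)
      ≈⟨ +-cong (trans (*-identityˡ _) (det-sum-column₀ v N (g ∘ suc)))
                (trans (*-identityˡ _)
                  (det-equal-columns (λ i → N i (g zero) ∷ N i) zero (suc (g zero)) (s≤s z≤n) λ _ → refl)) ⟩
    det (λ i → v i ∷ N i) + 0#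
      ≈⟨ +-identityʳ _ ⟩
    det (λ i → v i ∷ N i) ∎
    where
    rest : Vector Carrier (suc m)
    rest i = sum (λ l → N i (g (suc l)))

  -- The shift adds multiples of the first column, all ones, to the others. Changing one `t j` at a
  -- time does not alter the determinant, so `t` may be replaced by zero.
  det-shift-columns : ∀ {m} (N : Fin (suc m) → Vector Carrier m) (t : Vector Carrier m) →
    det (λ i → 1# ∷ (λ j → N i j + t j)) ≈ det (λ i → 1# ∷ N i)
  det-shift-columns {m} N t = begin
    det (shifted t)            ≈⟨ coordinatewise-constant (det ∘ shifted) shifted-cong shifted-indep t (const 0#) ⟩
    det (shifted (const 0#))   ≈⟨ det-columns-cong (shifted (const 0#)) (const 1#) N
                                    (λ i → refl) (λ i j → +-identityʳ (N i j)) ⟩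
    det (λ i → 1# ∷ N i)       ∎
    where
    shifted : Vector Carrier m → Matrix Carrier (suc m)
    shifted t i = 1# ∷ (λ j → N i j + t j)

    shifted-cong : ∀ s t → (∀ j → s j ≈ t j) → det (shifted s) ≈ det (shifted t)
    shifted-cong s t s≈t = det-columns-cong (shifted s) (const 1#) (λ i j → N i j + t j)
      (λ i → refl) (λ i j → +-congˡ (s≈t j))

    shifted-indep : ∀ k s t → (∀ j → j ≢ k → s j ≈ t j) → det (shifted s) ≈ det (shifted t)
    shifted-indep k s t s≈t = begin
      det (shifted s)
        ≈⟨ det-column-linear (suc k) (shifted t) B (shifted s) 1# (s k - t k)
             off
             (λ i j j≢k → trans (setColumn-off (shifted t) (suc k) (const 1#) i j j≢k) (off i j j≢k))
             (λ i → begin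
               N i k + s k
                 ≈⟨ solve 3 (λ n s t → n :+ s := con (+ 1) :* (n :+ t) :+ (s :+ :- t) :* con (+ 1))
                      refl (N i k) (s k) (t k) ⟩
               1# * (N i k + t k) + (s k - t k) * 1#
                 ≈⟨ +-congˡ (*-congˡ (setColumn-at (shifted t) (suc k) (const 1#) i)) ⟨
               1# * (N i k + t k) + (s k - t k) * B i (suc k) ∎) ⟩
      1# * det (shifted t) + (s k - t k) * det B
        ≈⟨ +-congˡ (*-congˡ (det-equal-columns B zero (suc k) (s≤s z≤n) λ i →
             sym (setColumn-at (shifted t) (suc k) (const 1#) i))) ⟩
      1# * det (shifted t) + (s k - t k) * 0#
        ≈⟨ solve 2 (λ x y → con (+ 1) :* x :+ y :* con (+ 0) := x) refl (det (shifted t)) (s k - t k) ⟩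
      det (shifted t) ∎
      where
      -- Changing `t k` to `s k` adds `s k - t k` times `det B`, where `B` has a second column of
      -- ones and hence determinant zero.
      B : Matrix Carrier (suc m)
      B = setColumn (shifted t) (suc k) (const 1#)
      off : ∀ i j → j ≢ suc k → shifted t i j ≈ shifted s i j
      off i zero    _   = refl
      off i (suc j) j≢k = +-congˡ (sym (s≈t j (j≢k ∘ ≡.cong suc)))

  -- Adding all other columns to the first makes it constantly `r`, and `r` factors out by
  -- linearity.
  det-constant-row-sums : ∀ {m} (M : Matrix Carrier (suc m)) r → (∀ i → sum (M i) ≈ r) →
    det M ≈ r * det (λ i → 1# ∷ tail (M i))
  det-constant-row-sums M r sums = begin
    det M
      ≈⟨ det-columns-cong M (λ i → M i zero) (λ i → tail (M i)) (λ i → refl) (λ i j → refl) ⟩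
    det (λ i → M i zero ∷ tail (M i))
      ≈⟨ det-sum-column₀ (λ i → M i zero) (λ i → tail (M i)) (λ j → j) ⟨
    det (λ i → sum (M i) ∷ tail (M i))
      -- Homogeneity is the case of linearity whose second coefficient is zero.
      ≈⟨ det-column₀-linear (λ i → tail (M i)) (const 1#) (const 1#) (λ i → sum (M i)) r 0#
           (λ i → trans (sums i)
             (solve 1 (λ r → r := r :* con (+ 1) :+ con (+ 0) :* con (+ 1)) refl r)) ⟩
    r * det (λ i → 1# ∷ tail (M i)) + 0# * det (λ i → 1# ∷ tail (M i))
      ≈⟨ trans (+-congˡ (zeroˡ _)) (+-identityʳ _) ⟩
    r * det (λ i → 1# ∷ tail (M i)) ∎

  -- As `t` sums to zero, both matrices have row sums `r`. Both determinants are then `r` times one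
  -- with first column of ones, where the shift has no effect.
  det-shift-rows : ∀ {m} (M : Matrix Carrier (suc m)) (t : Vector Carrier (suc m)) r →
    (∀ i → sum (M i) ≈ r) → sum t ≈ 0# →
    det (λ i j → M i j + t j) ≈ det M
  det-shift-rows M t r sums t≈0 = begin
    det (λ i j → M i j + t j)
      ≈⟨ det-constant-row-sums (λ i j → M i j + t j) r (λ i → begin
           sum (λ j → M i j + t j)  ≈⟨ ∑-distrib-+ (M i) t ⟩
           sum (M i) + sum t        ≈⟨ +-cong (sums i) t≈0 ⟩
           r + 0#                   ≈⟨ +-identityʳ r ⟩
           r                        ∎) ⟩
    r * det (λ i → 1# ∷ (λ j → M i (suc j) + t (suc j)))
      ≈⟨ *-congˡ (det-shift-columns (λ i → tail (M i)) (tail t)) ⟩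
    r * det (λ i → 1# ∷ tail (M i))
      ≈⟨ det-constant-row-sums M r sums ⟨
    det M ∎

-- Finite sums of negatives and differences.

module SumDifference {c ℓ} (R : CommutativeRing c ℓ) where
  open CommutativeRing R hiding (zero)
  open Sum +-commutativeMonoid
  open RingProperties ring using (-0#≈0#; -‿+-comm)

  sum-neg : ∀ {n} (x : Vector Carrier n) → sum (λ i → - x i) ≈ - sum x
  sum-neg {zero}  x = sym -0#≈0#
  sum-neg {suc n} x = trans (+-congˡ (sum-neg (tail x))) (-‿+-comm (x zero) (sum (tail x)))

  sum-difference : ∀ {n} (x y : Vector Carrier n) →
    sum (λ i → x i - y i) ≈ sum x - sum y
  sum-difference x y = trans (∑-distrib-+ x (λ i → - y i)) (+-congˡ (sum-neg y))

-- Constructive order on the reals and monotonicity of the square root.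

module RealOrder {c ℓ} (ℝ : Reals c ℓ) where
  open Reals ℝ
  open SquareRoot ℝ
  open IntegerRingSolver commutativeRing
  open Sum +-commutativeMonoid using (sum)
  open Mult semiring renaming (_×_ to _·_)

  -- Units of a Heyting field are apart from zero, and apartness here means strict inequality in one
  -- direction.
  unit⇒positive⊎negative : ∀ {x y} → x * y ≈ 1# → 0# < x ⊎ x < 0#
  unit⇒positive⊎negative {x} {y} xy≈1
    with IsHeytingField.invertible⇒# isHeytingField {x} {0#}
      (y , trans (solve 2 (λ x y → y :* (x :+ :- con (+ 0)) := x :* y) refl x y) xy≈1
         , trans (solve 2 (λ x y → (x :+ :- con (+ 0)) :* y := x :* y) refl x y) xy≈1)
  ... | inj₁ x<0 = inj₂ x<0
  ... | inj₂ 0<x = inj₁ 0<x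

  x<y⇒0<y-x : ∀ {x y} → x < y → 0# < y - x
  x<y⇒0<y-x {x} x<y = <-respˡ-≈ (-‿inverseʳ x) (+-monoˡ-< (- x) x<y)

  0<y-x⇒x<y : ∀ {x y} → 0# < y - x → x < y
  0<y-x⇒x<y {x} {y} 0<y-x = <-respˡ-≈ (+-identityˡ x)
    (<-respʳ-≈ (solve 2 (λ x y → y :+ :- x :+ x := y) refl x y) (+-monoˡ-< x 0<y-x))

  x<0⇒0<-x : ∀ {x} → x < 0# → 0# < - x
  x<0⇒0<-x x<0 = <-respʳ-≈ (+-identityˡ _) (x<y⇒0<y-x x<0)

  *-neg : ∀ {x y} → x < 0# → y < 0# → 0# < x * y
  *-neg {x} {y} x<0 y<0 =
    <-respʳ-≈ (solve 2 (λ x y → :- x :* :- y := x :* y) refl x y)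
      (*-pos (x<0⇒0<-x x<0) (x<0⇒0<-x y<0))

  0<1 : 0# < 1#
  0<1 with unit⇒positive⊎negative (*-identityˡ 1#)
  ... | inj₁ 0<1 = 0<1
  ... | inj₂ 1<0 = <-respʳ-≈ (*-identityˡ 1#) (*-neg 1<0 1<0)

  <⇒≤ : ∀ {x y} → x < y → x ≤ y
  <⇒≤ = <-asym

  ≤-respʳ-≈ : ∀ {x y z} → y ≈ z → x ≤ y → x ≤ z
  ≤-respʳ-≈ y≈z x≤y z<x = x≤y (<-respˡ-≈ (sym y≈z) z<x)

  ≤-antisym : ∀ {x y} → x ≤ y → y ≤ x → x ≈ y
  ≤-antisym {x} {y} x≤y y≤x = proj₁ (tight x y) λ where
    (inj₁ x<y) → y≤x x<y
    (inj₂ y<x) → x≤y y<x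

  ≤-<-trans : ∀ {x y z} → x ≤ y → y < z → x < z
  ≤-<-trans {x} x≤y y<z with <-cotrans y<z x
  ... | inj₁ y<x = contradiction y<x x≤y
  ... | inj₂ x<z = x<z

  ≤-trans : ∀ {x y z} → x ≤ y → y ≤ z → x ≤ z
  ≤-trans x≤y y≤z z<x = y≤z (<-≤-trans z<x x≤y)
    where
    <-≤-trans : ∀ {x y z} → x < y → y ≤ z → x < z
    <-≤-trans {z = z} x<y y≤z with <-cotrans x<y z
    ... | inj₁ x<z = x<z
    ... | inj₂ z<y = contradiction z<y y≤z

  x≤y⇒0≤y-x : ∀ {x y} → x ≤ y → 0# ≤ y - x
  x≤y⇒0≤y-x {x} {y} x≤y y-x<0 = x≤y (0<y-x⇒x<y
    (<-respʳ-≈ (solve 2 (λ x y → :- (y :+ :- x) := x :+ :- y) refl x y) (x<0⇒0<-x y-x<0)))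

  0≤y-x⇒x≤y : ∀ {x y} → 0# ≤ y - x → x ≤ y
  0≤y-x⇒x≤y {x} {y} 0≤y-x y<x = 0≤y-x
    (<-respʳ-≈ (-‿inverseʳ x) (+-monoˡ-< (- x) y<x))

  +-nonneg : ∀ {x y} → 0# ≤ x → 0# ≤ y → 0# ≤ x + y
  +-nonneg {x} {y} 0≤x 0≤y x+y<0 with <-cotrans x+y<0 y
  ... | inj₁ x+y<y = 0≤x (<-respˡ-≈ (solve 2 (λ x y → x :+ y :+ :- y := x) refl x y)
          (<-respʳ-≈ (-‿inverseʳ y) (+-monoˡ-< (- y) x+y<y)))
  ... | inj₂ y<0 = 0≤y y<0

  -- Signs cannot be decided, so suppose `x * y < 0#`. If `x` were positive, `y` could not be, so
  -- `y` would be zero, which is absurd; hence `x` is zero, again absurd.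
  *-nonneg : ∀ {x y} → 0# ≤ x → 0# ≤ y → 0# ≤ x * y
  *-nonneg {x} {y} 0≤x 0≤y xy<0 = <-irrefl (trans (*-congʳ x≈0) (zeroˡ y)) xy<0
    where
    x≤0 : x ≤ 0#
    x≤0 0<x = <-irrefl (trans (*-congˡ y≈0) (zeroʳ x)) xy<0
      where
      y≈0 : y ≈ 0#
      y≈0 = ≤-antisym (λ 0<y → <-asym (*-pos 0<x 0<y) xy<0) 0≤y
    x≈0 : x ≈ 0#
    x≈0 = ≤-antisym x≤0 0≤x

  square-nonneg : ∀ x → 0# ≤ x * x
  square-nonneg x x²<0 = <-irrefl (trans (*-congʳ x≈0) (zeroˡ x)) x²<0
    where
    x≈0 : x ≈ 0#
    x≈0 = ≤-antisym (λ 0<x → <-asym (*-pos 0<x 0<x) x²<0)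
                    (λ x<0 → <-asym (*-neg x<0 x<0) x²<0)

  square-nonpos⇒≈0 : ∀ {x} → x * x ≤ 0# → x ≈ 0#
  square-nonpos⇒≈0 x²≤0 = ≤-antisym (λ 0<x → x²≤0 (*-pos 0<x 0<x))
                                    (λ x<0 → x²≤0 (*-neg x<0 x<0))

  sum-nonneg : ∀ {n} (f : Vector Carrier n) → (∀ i → 0# ≤ f i) → 0# ≤ sum f
  sum-nonneg {zero}  f 0≤f = <-irrefl refl
  sum-nonneg {suc n} f 0≤f = +-nonneg (0≤f zero) (sum-nonneg (tail f) λ i → 0≤f (suc i))

  term≤sum : ∀ {n} (f : Vector Carrier n) → (∀ i → 0# ≤ f i) → ∀ i → f i ≤ sum f
  term≤sum f 0≤f zero = 0≤y-x⇒x≤y (≤-respʳ-≈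
    (solve 2 (λ x s → s := x :+ s :+ :- x) refl (f zero) (sum (tail f)))
    (sum-nonneg (tail f) λ i → 0≤f (suc i)))
  term≤sum f 0≤f (suc i) = ≤-trans (term≤sum (tail f) (λ j → 0≤f (suc j)) i)
    (0≤y-x⇒x≤y (≤-respʳ-≈
      (solve 2 (λ x s → x := x :+ s :+ :- s) refl (f zero) (sum (tail f)))
      (0≤f zero)))

  positive⇒inverse : ∀ {x} → 0# < x → ∃[ y ] (0# < y × x * y ≈ 1#)
  positive⇒inverse {x} 0<x with #⇒invertible {x} {0#} (inj₂ 0<x)
  ... | y , y[x-0]≈1 , _ = y , 0<y , trans (*-comm x y) yx≈1
    where
    yx≈1 : y * x ≈ 1#
    yx≈1 = trans (solve 2 (λ x y → y :* x := y :* (x :+ :- con (+ 0))) refl x y) y[x-0]≈1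
    0<y : 0# < y
    0<y with unit⇒positive⊎negative yx≈1
    ... | inj₁ 0<y = 0<y
    -- A negative `y` would make `x * - y`, which is minus one, positive.
    ... | inj₂ y<0 = contradiction (0<y-x⇒x<y (<-respʳ-≈ x[-y]≈0-1 (*-pos 0<x (x<0⇒0<-x y<0))))
                       (<-asym 0<1)
      where
      x[-y]≈0-1 : x * - y ≈ 0# - 1#
      x[-y]≈0-1 = trans (solve 2 (λ x y → x :* :- y := con (+ 0) :+ :- (y :* x)) refl x y)
        (+-congˡ (-‿cong yx≈1))

  positive-multiple : ∀ n → 0# < suc n · 1#
  positive-multiple zero    = <-respʳ-≈ (sym (+-identityʳ 1#)) 0<1
  positive-multiple (suc n) = <-trans 0<1 (<-respˡ-≈ (+-identityʳ 1#)
    (<-respʳ-≈ (+-comm _ _) (<-respˡ-≈ (+-comm 0# 1#) (+-monoˡ-< 1# (positive-multiple n)))))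

  √-nonneg : ∀ a → 0# ≤ √ a
  √-nonneg a = proj₁ (proj₂ (√-sup a)) (inj₁ (<-irrefl refl))

  -- `Below√ a` is contained in `Below√ b`, so `√ b` bounds it.
  √-mono-≤ : ∀ {a b} → a ≤ b → √ a ≤ √ b
  √-mono-≤ {a} {b} a≤b = proj₂ (proj₂ (√-sup a)) (√ b) λ where
    (inj₁ p≤0)  → proj₁ (proj₂ (√-sup b)) (inj₁ p≤0)
    (inj₂ p²≤a) → proj₁ (proj₂ (√-sup b)) (inj₂ (≤-trans p²≤a a≤b))

  -- A single shift δ moves every element of Below√ b into Below√ a: it suffices that
  -- δ (2 √b + δ) ≤ a − b, and δ = (a − b) / (1 + 2 √b + (a − b)) does it.
  √-mono-< : ∀ {a b} → 0# ≤ b → b < a → √ b < √ a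
  √-mono-< {a} {b} 0≤b b<a =
    ≤-<-trans (proj₂ (proj₂ (√-sup b)) (√ a - δ) √a-δ-bound)
      (0<y-x⇒x<y (<-respʳ-≈ (solve 2 (λ x y → y := x :+ :- (x :+ :- y)) refl (√ a) δ) 0<δ))
    where
    s d e w δ : Carrier
    s = √ b
    d = a - b
    e = (d + (s + s)) + 1#

    0≤s : 0# ≤ s
    0≤s = √-nonneg b
    0<d : 0# < d
    0<d = x<y⇒0<y-x b<a
    0≤d+2s : 0# ≤ d + (s + s)
    0≤d+2s = +-nonneg (<⇒≤ 0<d) (+-nonneg 0≤s 0≤s)
    0<e : 0# < e
    0<e = ≤-<-trans 0≤d+2s (<-respʳ-≈ (+-comm 1# _)
            (<-respˡ-≈ (+-identityˡ _) (+-monoˡ-< (d + (s + s)) 0<1)))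

    w = proj₁ (positive⇒inverse 0<e)
    δ = d * w

    0<δ : 0# < δ
    0<δ = *-pos 0<d (proj₁ (proj₂ (positive⇒inverse 0<e)))
    0≤δ : 0# ≤ δ
    0≤δ = <⇒≤ 0<δ
    δe≈d : δ * e ≈ d
    δe≈d = trans (solve 3 (λ d w e → d :* w :* e := d :* (e :* w)) refl d w e)
      (trans (*-congˡ (proj₂ (proj₂ (positive⇒inverse 0<e)))) (*-identityʳ d))
    0≤d-δ : 0# ≤ d - δ
    0≤d-δ = ≤-respʳ-≈
      (trans (solve 3 (λ x y z → x :* (y :+ (z :+ z)) := x :* (y :+ (z :+ z) :+ con (+ 1)) :+ :- x)
                refl δ d s)
             (+-congʳ δe≈d))
      (*-nonneg 0≤δ 0≤d+2s)
    0≤gap : 0# ≤ d - δ * (s + s + δ)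
    0≤gap = ≤-respʳ-≈
      -- As `δ * e` is `d`, the gap equals `δ * (d - δ + 1#)`.
      (trans (solve 3 (λ x y z → x :* (y :+ :- x :+ con (+ 1)) :=
                         x :* (y :+ (z :+ z) :+ con (+ 1)) :+ :- (x :* (z :+ z :+ x)))
                refl δ d s)
             (+-congʳ δe≈d))
      (*-nonneg 0≤δ (+-nonneg 0≤d-δ (<⇒≤ 0<1)))

    square≤a : ∀ p → Below√ b p → 0# < p + δ → (p + δ) * (p + δ) ≤ a
    square≤a p (inj₁ p≤0) 0<p+δ = 0≤y-x⇒x≤y (≤-respʳ-≈
      -- Splits `a - (p + δ)²` into nonnegative parts: `b`, the gap, `2sδ` and `-p(p + 2δ)`.
      (solve 5 (λ a b s x p →
         b :+ ((a :+ :- b) :+ :- (x :* (s :+ s :+ x))) :+ (s :* x :+ s :* x)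
           :+ (con (+ 0) :+ :- p) :* (x :+ (p :+ x))
         := a :+ :- ((p :+ x) :* (p :+ x))) refl a b s δ p)
      (+-nonneg (+-nonneg (+-nonneg 0≤b 0≤gap)
        (+-nonneg (*-nonneg 0≤s 0≤δ) (*-nonneg 0≤s 0≤δ)))
        (*-nonneg (x≤y⇒0≤y-x p≤0) (+-nonneg 0≤δ (<⇒≤ 0<p+δ)))))
    square≤a p (inj₂ p²≤b) 0<p+δ = 0≤y-x⇒x≤y (≤-respʳ-≈
      -- Here the parts are `b - p²`, the gap and `2δ(s - p)`, where `p ≤ s` because `p` lies in
      -- `Below√ b`.
      (solve 5 (λ a b s x p →
         (b :+ :- (p :* p)) :+ ((a :+ :- b) :+ :- (x :* (s :+ s :+ x)))
           :+ (x :+ x) :* (s :+ :- p)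
         := a :+ :- ((p :+ x) :* (p :+ x))) refl a b s δ p)
      (+-nonneg (+-nonneg (x≤y⇒0≤y-x p²≤b) 0≤gap)
        (*-nonneg (+-nonneg 0≤δ 0≤δ)
          (x≤y⇒0≤y-x (proj₁ (proj₂ (√-sup b)) (inj₂ p²≤b))))))

    -- Otherwise `p + δ` exceeds `√ a`, hence is positive, and yet belongs to `Below√ a`.
    √a-δ-bound : UpperBound (Below√ b) (√ a - δ)
    √a-δ-bound {p} p∈ √a-δ<p =
      proj₁ (proj₂ (√-sup a)) (inj₂ (square≤a p p∈ (≤-<-trans (√-nonneg a) √a<p+δ))) √a<p+δ
      where
      √a<p+δ : √ a < p + δ
      √a<p+δ = <-respˡ-≈ (solve 2 (λ x y → x :+ :- y :+ y := x) refl (√ a) δ) (+-monoˡ-< δ √a-δ<p)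

-- Column shifts of a real matrix and the Frobenius norm.

module DoublyStochasticProjection {c ℓ} (ℝ : Reals c ℓ) where
  open RealMatrices ℝ
  open RealOrder ℝ
  open IntegerRingSolver commutativeRing
  open SumDifference commutativeRing
  open Sum +-commutativeMonoid
    using (sum-cong-≋; ∑-distrib-+; ∑-comm; sum-replicate; sum-replicate-zero)
  open SemiringSum semiring using (*-distribˡ-sum)
  open Mult semiring using (×-assoc-*; ×-congʳ)
  open RingProperties ring using (-0#≈0#; x∙y⁻¹≈ε⇒x≈y)
  open import Relation.Binary.Reasoning.Setoid setoid

  private
    module ℂR where
      open CommutativeRing ℂ-commutativeRing public
      open Sum (CommutativeRing.+-commutativeMonoid ℂ-commutativeRing) public
        using (sum; sum-replicate-zero)
      open SumDifference ℂ-commutativeRing public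
    open DeterminantProperties ℂ-commutativeRing using (det-cong; det-shift-rows)

  shiftColumns : ∀ {n} → Matrix Carrier n → Vector Carrier n → Matrix Carrier n
  shiftColumns A t i j = A i j + t j

  ·-*-assoc : ∀ n x → n · x ≈ (n · 1#) * x
  ·-*-assoc n x = sym (trans (×-assoc-* n 1# x) (×-congʳ n (*-identityˡ x)))

  squaredNorm : ∀ {n} → Matrix Carrier n → Carrier
  squaredNorm X = sum λ i → sum λ j → X i j * X i j

  rowSquaredNorm-nonneg : ∀ {n} (X : Matrix Carrier n) i → 0# ≤ sum (λ j → X i j * X i j)
  rowSquaredNorm-nonneg X i = sum-nonneg (λ j → X i j * X i j) λ j → square-nonneg (X i j)

  squaredNorm-nonneg : ∀ {n} (X : Matrix Carrier n) → 0# ≤ squaredNorm X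
  squaredNorm-nonneg X = sum-nonneg _ (rowSquaredNorm-nonneg X)

  squaredNorm-nonpos⇒≈0 : ∀ {n} (X : Matrix Carrier n) → squaredNorm X ≤ 0# → ∀ i j → X i j ≈ 0#
  squaredNorm-nonpos⇒≈0 X X≤0 i j = square-nonpos⇒≈0 (≤-trans
    (term≤sum (λ j → X i j * X i j) (λ j → square-nonneg (X i j)) j)
    (≤-trans (term≤sum (λ i → sum λ j → X i j * X i j) (rowSquaredNorm-nonneg X) i) X≤0))

  -- `A ⊖ B` is `- t j` throughout column `j`, so the cross terms there are a constant times the
  -- entries of `B ⊖ C`, which sum to zero.
  pythagoras : ∀ {n} (A C : Matrix Carrier n) (t : Vector Carrier n) → let B = shiftColumns A t in
    (∀ j → columnSum B j ≈ columnSum C j) →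
    squaredNorm (A ⊖ C) ≈ squaredNorm (A ⊖ B) + squaredNorm (B ⊖ C)
  pythagoras {n} A C t B≈C = begin
    squaredNorm (A ⊖ C)
      ≈⟨ sum-cong-≋ (λ i → trans (sum-cong-≋ (entry i)) (∑-distrib-+ (λ j → u i j + v i j) (cross i))) ⟩
    sum (λ i → sum (λ j → u i j + v i j) + sum (cross i))
      ≈⟨ ∑-distrib-+ (λ i → sum (λ j → u i j + v i j)) (λ i → sum (cross i)) ⟩
    sum (λ i → sum (λ j → u i j + v i j)) + sum (λ i → sum (cross i))
      ≈⟨ +-cong (trans (sum-cong-≋ (λ i → ∑-distrib-+ (u i) (v i)))
                       (∑-distrib-+ (λ i → sum (u i)) (λ i → sum (v i))))
                cross≈0 ⟩
    (squaredNorm (A ⊖ B) + squaredNorm (B ⊖ C)) + 0#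
      ≈⟨ +-identityʳ _ ⟩
    squaredNorm (A ⊖ B) + squaredNorm (B ⊖ C) ∎
    where
    B u v cross : Matrix Carrier n
    B = shiftColumns A t
    u i j = (A ⊖ B) i j * (A ⊖ B) i j
    v i j = (B ⊖ C) i j * (B ⊖ C) i j
    cross i j = - (t j + t j) * (B i j - C i j)

    entry : ∀ i j → (A ⊖ C) i j * (A ⊖ C) i j ≈ (u i j + v i j) + cross i j
    entry i j = solve 3 (λ a c t →
      (a :+ :- c) :* (a :+ :- c) :=
      ((a :+ :- (a :+ t)) :* (a :+ :- (a :+ t)) :+ (a :+ t :+ :- c) :* (a :+ t :+ :- c))
        :+ :- (t :+ t) :* (a :+ t :+ :- c)) refl (A i j) (C i j) (t j)

    column≈0 : ∀ j → sum (λ i → cross i j) ≈ 0#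
    column≈0 j = begin
      sum (λ i → cross i j)
        ≈⟨ *-distribˡ-sum (- (t j + t j)) (λ i → B i j - C i j) ⟨
      - (t j + t j) * sum (λ i → B i j - C i j)
        ≈⟨ *-congˡ (sum-difference (λ i → B i j) (λ i → C i j)) ⟩
      - (t j + t j) * (columnSum B j - columnSum C j)
        ≈⟨ *-congˡ (trans (+-congʳ (B≈C j)) (-‿inverseʳ (columnSum C j))) ⟩
      - (t j + t j) * 0#
        ≈⟨ zeroʳ _ ⟩
      0# ∎

    cross≈0 : sum (λ i → sum (cross i)) ≈ 0#
    -- The cancellation is down columns, so the order of summation is exchanged first.
    cross≈0 = trans (∑-comm cross) (trans (sum-cong-≋ column≈0)
      (sum-replicate-zero n))

  -- Minimality: the excess `‖B - C‖²` is nonnegative. Uniqueness: were it positive, strict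
  -- monotonicity of the root would make `C` strictly farther than `B`; so it is zero, and so is
  -- each entry of `B ⊖ C`.
  shiftColumns-uniqueClosest : ∀ {n} (A : Matrix Carrier n) (t : Vector Carrier n) →
    IsDoublyStochastic (shiftColumns A t) →
    IsUniqueClosestDoublyStochastic A (shiftColumns A t)
  shiftColumns-uniqueClosest A t B-ds =
    (B-ds , λ C C-ds → √-mono-≤ (0≤y-x⇒x≤y (≤-respʳ-≈ (sym (excess C C-ds))
      (squaredNorm-nonneg (B ⊖ C))))) ,
    λ C (C-ds , C-closest) i j → sym (x∙y⁻¹≈ε⇒x≈y (B i j) (C i j)
      (squaredNorm-nonpos⇒≈0 (B ⊖ C)
        (λ 0<‖B-C‖² → C-closest B B-ds
          (√-mono-< (squaredNorm-nonneg (A ⊖ B))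
            (0<y-x⇒x<y (<-respʳ-≈ (sym (excess C C-ds)) 0<‖B-C‖²))))
        i j))
    where
    B = shiftColumns A t
    excess : ∀ C → IsDoublyStochastic C →
      squaredNorm (A ⊖ C) - squaredNorm (A ⊖ B) ≈ squaredNorm (B ⊖ C)
    excess C C-ds = trans
      (+-congʳ (pythagoras A C t λ j → trans (proj₂ B-ds j) (sym (proj₂ C-ds j))))
      (solve 2 (λ x y → x :+ y :+ :- x := y) refl (squaredNorm (A ⊖ B)) (squaredNorm (B ⊖ C)))

  -- Invariance of the characteristic polynomial.

  sum-fromℝ : ∀ {n} (x : Vector Carrier n) → ℂR.sum (λ i → fromℝ (x i)) ≈ℂ fromℝ (sum x)
  sum-fromℝ {zero}  x = ℂR.refl {0ℂ}
  sum-fromℝ {suc n} x =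
    +-congˡ (proj₁ (sum-fromℝ (tail x))) , trans (+-identityˡ _) (proj₂ (sum-fromℝ (tail x)))

  sum-indicator : ∀ {n} (i : Fin n) z → ℂR.sum (λ j → if does (i ≟ j) then z else 0ℂ) ≈ℂ z
  sum-indicator {suc n} zero z =
    ℂR.trans {z +ℂ _} {z +ℂ 0ℂ} {z}
      (ℂR.+-congˡ {z} {_} {0ℂ} (ℂR.sum-replicate-zero n)) (ℂR.+-identityʳ z)
  sum-indicator (suc i) z =
    ℂR.trans {0ℂ +ℂ S} {S} {z} (ℂR.+-identityˡ S) (sum-indicator i z)
    where
    S = ℂR.sum (λ j → if does (i ≟ j) then z else 0ℂ)

  -- Every row of `z I- A` sums to `z - 1`, and shifting `A` by `t` shifts this matrix by `- t`,
  -- whose sum is zero.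
  charPoly-shiftColumns : ∀ {m} (A : Matrix Carrier (suc m)) (t : Vector Carrier (suc m)) →
    (∀ i → rowSum A i ≈ 1#) → sum t ≈ 0# →
    ∀ z → charPoly (shiftColumns A t) z ≈ℂ charPoly A z
  charPoly-shiftColumns A t rows t≈0 z =
    ℂR.trans {det (z I- B)} {det shifted} {det (z I- A)}
      (det-cong (z I- B) shifted entry)
      (det-shift-rows (z I- A) (λ j → -ℂ fromℝ (t j)) (z +ℂ -ℂ 1ℂ) row-sums -t≈0)
    where
    B = shiftColumns A t
    shifted : Matrix ℂ _
    shifted i j = (z I- A) i j +ℂ -ℂ fromℝ (t j)

    entry : ∀ i j → (z I- B) i j ≈ℂ shifted i j
    entry i j =
      solve 3 (λ x y z → x :+ :- (y :+ z) := x :+ :- y :+ :- z) refl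
        (proj₁ (if does (i ≟ j) then z else 0ℂ)) (A i j) (t j) ,
      solve 1 (λ x → x :+ :- con (+ 0) := x :+ :- con (+ 0) :+ :- con (+ 0)) refl
        (proj₂ (if does (i ≟ j) then z else 0ℂ))

    row-sums : ∀ i → ℂR.sum ((z I- A) i) ≈ℂ z +ℂ -ℂ 1ℂ
    row-sums i = ℂR.trans {ℂR.sum ((z I- A) i)} {S +ℂ -ℂ T} {z +ℂ -ℂ 1ℂ}
      (ℂR.sum-difference (λ j → if does (i ≟ j) then z else 0ℂ) (λ j → fromℝ (A i j)))
      (ℂR.+-cong {S} {z} { -ℂ T} { -ℂ 1ℂ} (sum-indicator i z)
        (ℂR.-‿cong {T} {1ℂ} (ℂR.trans {T} {fromℝ (rowSum A i)} {1ℂ}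
          (sum-fromℝ (A i)) (rows i , refl))))
      where
      S = ℂR.sum (λ j → if does (i ≟ j) then z else 0ℂ)
      T = ℂR.sum (λ j → fromℝ (A i j))

    -t≈0 : ℂR.sum (λ j → -ℂ fromℝ (t j)) ≈ℂ 0ℂ
    -t≈0 = ℂR.trans {ℂR.sum (λ j → -ℂ fromℝ (t j))} { -ℂ ℂR.sum (λ j → fromℝ (t j))} {0ℂ}
      (ℂR.sum-neg (λ j → fromℝ (t j)))
      (trans (-‿cong (trans (proj₁ (sum-fromℝ t)) t≈0)) -0#≈0# ,
       trans (-‿cong (proj₂ (sum-fromℝ t))) -0#≈0#)

  spectrum-transfer : ∀ {n} (A B : Matrix Carrier n) → (∀ z → charPoly A z ≈ℂ charPoly B z) →
    ∀ μ → IsSpectrum A μ → IsSpectrum B μ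
  spectrum-transfer A B A≈B μ A-spectrum z =
    ℂR.trans {charPoly B z} {charPoly A z} {product (λ i → z +ℂ -ℂ μ i)}
      (ℂR.sym {charPoly A z} {charPoly B z} (A≈B z)) (A-spectrum z)

  -- The shift that makes all column sums one.

  module Balancing {m} (A : Matrix Carrier (suc m)) (rows : ∀ i → rowSum A i ≈ 1#) where
    n : ℕ
    n = suc m

    -- The number `n` as a real, and its inverse.
    ν w : Carrier
    ν = n · 1#

    ν-inverse : ∃[ w ] (0# < w × ν * w ≈ 1#)
    ν-inverse = positive⇒inverse (positive-multiple m)
    w = proj₁ ν-inverse

    νw≈1 : ν * w ≈ 1#
    νw≈1 = proj₂ (proj₂ ν-inverse)

    t : Vector Carrier n
    t j = w * (1# - columnSum A j)

    balanced : Matrix Carrier n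
    balanced = shiftColumns A t

    sum-const : ∀ x → sum {n} (λ _ → x) ≈ ν * x
    sum-const x = trans (sum-replicate n) (·-*-assoc n x)

    νt≈1-s : ∀ j → ν * t j ≈ 1# - columnSum A j
    νt≈1-s j = trans (sym (*-assoc ν w _)) (trans (*-congʳ νw≈1) (*-identityˡ _))

    t≈0 : sum t ≈ 0#
    t≈0 = begin
      sum t                                  ≈⟨ *-distribˡ-sum w (λ j → 1# - columnSum A j) ⟨
      w * sum (λ j → 1# - columnSum A j)     ≈⟨ *-congˡ (sum-difference (λ _ → 1#) (columnSum A)) ⟩
      w * (sum {n} (λ _ → 1#) - sum (columnSum A))
        -- The column sums have the same total as the row sums, each of which is one.
        ≈⟨ *-congˡ (+-congˡ (-‿cong (trans (sym (∑-comm A)) (sum-cong-≋ rows)))) ⟩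
      w * (sum {n} (λ _ → 1#) - sum {n} (λ _ → 1#))
        ≈⟨ *-congˡ (-‿inverseʳ (sum {n} (λ _ → 1#))) ⟩
      w * 0#                                 ≈⟨ zeroʳ w ⟩
      0#                                     ∎

    balanced-rowSum : ∀ i → rowSum balanced i ≈ 1#
    balanced-rowSum i = trans (∑-distrib-+ (A i) t) (trans (+-cong (rows i) t≈0) (+-identityʳ 1#))

    balanced-columnSum : ∀ j → columnSum balanced j ≈ 1#
    balanced-columnSum j = begin
      columnSum balanced j                     ≈⟨ ∑-distrib-+ (λ i → A i j) (λ _ → t j) ⟩
      columnSum A j + sum {n} (λ _ → t j)      ≈⟨ +-congˡ (trans (sum-const (t j)) (νt≈1-s j)) ⟩
      columnSum A j + (1# - columnSum A j)     ≈⟨ solve 2 (λ s o → s :+ (o :+ :- s) := o) refl (columnSum A j) 1# ⟩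
      1#                                       ∎

    -- The entry is `1/n` times the sum of `n (A i j - a j)` and `1 + n a j - s j`; the first is
    -- nonnegative because `a j` bounds column `j` from below, the second by the column-sum
    -- hypothesis.
    balanced-nonneg : (a : Vector Carrier n) → (∀ i j → a j ≤ A i j) →
      (∀ j → columnSum A j ≤ 1# + n · a j) → ∀ i j → 0# ≤ balanced i j
    balanced-nonneg a a≤A s≤1+na i j = ≤-respʳ-≈ (begin
      w * (ν * (A i j - a j) + (1# + n · a j - columnSum A j))
        ≈⟨ *-congˡ (+-congˡ (+-congʳ (+-congˡ (·-*-assoc n (a j))))) ⟩
      w * (ν * (A i j - a j) + (1# + ν * a j - columnSum A j))
        ≈⟨ solve 6 (λ w v x a o s → w :* (v :* (x :+ :- a) :+ (o :+ v :* a :+ :- s)) :=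
                      (v :* w) :* x :+ w :* (o :+ :- s))
             refl w ν (A i j) (a j) 1# (columnSum A j) ⟩
      (ν * w) * A i j + t j
        ≈⟨ +-congʳ (trans (*-congʳ νw≈1) (*-identityˡ (A i j))) ⟩
      balanced i j ∎)
      (*-nonneg (<⇒≤ (proj₁ (proj₂ ν-inverse)))
        (+-nonneg (*-nonneg (<⇒≤ (positive-multiple m)) (x≤y⇒0≤y-x (a≤A i j)))
                  (x≤y⇒0≤y-x (s≤1+na j))))

theorem2p8 : ∀ {c ℓ} (ℝ : Reals c ℓ) → let open RealMatrices ℝ in
    (m : ℕ) → let n = suc m in
    (A : Matrix Carrier n) (λs : Vector ℂ m) →
    IsStochastic A →
    IsPerronSpectrum A 1# λs →
    (a : Vector Carrier n) → (∀ j → IsSmallestEntry (λ i → A i j) (a j)) →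
    (∀ j → columnSum A j ≤ 1# + n · a j) →
    ∃[ B ] ( IsDoublyStochastic B
    × IsPerronSpectrum B 1# λs
    × IsUniqueClosestDoublyStochastic A B
    × Cospectral A B )
theorem2p8 ℝ m A λs (_ , rows) (A-spectrum , σ≤1) a a-smallest s≤1+na =
  -- `σ≤1` speaks only of the list of eigenvalues, so it carries over from `A` unchanged.
  balanced , balanced-ds , (A⇒B (fromℝ 1# ∷ λs) A-spectrum , σ≤1) ,
  shiftColumns-uniqueClosest A t balanced-ds ,
  λ μ → mk⇔ (A⇒B μ) (spectrum-transfer balanced A B≈A μ)
  where
  open RealMatrices ℝ
  open DoublyStochasticProjection ℝ
  open Balancing A rows

  balanced-ds : IsDoublyStochastic balanced
  balanced-ds =
    (balanced-nonneg a (λ i j → proj₂ (a-smallest j) i) s≤1+na , balanced-rowSum) ,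
    balanced-columnSum

  B≈A : ∀ z → charPoly balanced z ≈ℂ charPoly A z
  B≈A = charPoly-shiftColumns A t rows t≈0

  A⇒B : ∀ μ → IsSpectrum A μ → IsSpectrum balanced μ
  A⇒B = spectrum-transfer A balanced λ z → sym (proj₁ (B≈A z)) , sym (proj₂ (B≈A z))
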